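{- The gap $\chi_\ell(G^2)-\chi(G^2)$ can be arbitrarily large: for every positive integer $N$ there exists a graph $G$ such that $\chi_\ell(G^2)-\chi(G^2)\ge N$.
   Context: Graphs are finite and simple. The square $G^2$ of a graph $G$ has vertex set $V(G)$, and two distinct vertices are adjacent in $G^2$ iff their distance in $G$ is at most $2$. $\chi$ is the chromatic number. The list chromatic number $\chi_\ell(H)$ is the least $k$ such that for every assignment $L$ of lists of colors with $|L(v)|\ge k$ for all $v\in V(H)$ there is a proper coloring $\phi$ of $H$ with $\phi(v)\in L(v)$ for all $v$. -}

module Defs where

open import Data.Fin using (Fin)
open import Data.Fin.Properties using (any?; _≟_)
open import Data.List using (List; length)
open import Data.List.Membership.Propositional using (_∈_)
open import Data.List.Relation.Unary.Unique.Propositional using (Unique)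
open import Data.Nat using (ℕ; zero; suc; _≤_; z≤n; s≤s; s≤s⁻¹)
open import Data.Product using (Σ-syntax; ∃-syntax; _×_; _,_)
open import Level using (0ℓ)
open import Relation.Binary using (Rel; Symmetric; Irreflexive; Decidable)
open import Relation.Binary.PropositionalEquality using (_≡_; _≢_; refl; sym)
open import Relation.Nullary using (Dec; yes; no; ¬?; _×-dec_)
open import Relation.Nullary.Decidable using (map′)

record Graph : Set₁ where
  field
    order    : ℕ
    _~_      : Rel (Fin order) 0ℓ
    ~-sym    : Symmetric _~_
    ~-irrefl : Irreflexive _≡_ _~_
    _~?_     : Decidable _~_

  V : Set
  V = Fin order

IsLeast : (ℕ → Set) → ℕ → Set
IsLeast P k = P k × (∀ j → P j → k ≤ j)

module _ (G : Graph) where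
  open Graph G

  data Walk : V → V → ℕ → Set where
    []  : ∀ {u} → Walk u u 0
    _∷_ : ∀ {u v w n} → u ~ v → Walk v w n → Walk u w (suc n)

  -- A shortest walk is a path. Vertices in different components have no distance,
  -- so they are not at distance at most any k.
  IsDistance : V → V → ℕ → Set
  IsDistance u v = IsLeast (Walk u v)

  DistanceAtMost : ℕ → V → V → Set
  DistanceAtMost k u v = ∃[ d ] (IsDistance u v d × d ≤ k)

  snoc : ∀ {u v w n} → Walk u v n → v ~ w → Walk u w (suc n)
  snoc []       f = f ∷ []
  snoc (e ∷ es) f = e ∷ snoc es f

  reverse : ∀ {u v n} → Walk u v n → Walk v u n
  reverse []       = []
  reverse (e ∷ es) = snoc (reverse es) (~-sym e)

  walk? : ∀ n u v → Dec (Walk u v n)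
  walk? zero    u v = map′ (λ { refl → [] }) (λ { [] → refl }) (u ≟ v)
  walk? (suc n) u v =
    map′ (λ (_ , e , es) → e ∷ es) (λ { (e ∷ es) → _ , e , es })
         (any? λ w → (u ~? w) ×-dec walk? n w v)

  distanceAtMost-sym : ∀ k → Symmetric (DistanceAtMost k)
  distanceAtMost-sym k (d , (p , least) , d≤k) =
    d , (reverse p , λ j q → least j (reverse q)) , d≤k

leastAtMost? : {P : ℕ → Set} → (∀ n → Dec (P n)) →
               ∀ k → Dec (∃[ d ] (IsLeast P d × d ≤ k))
leastAtMost? P? k with P? 0
... | yes p0 = yes (0 , (p0 , λ _ _ → z≤n) , z≤n)
leastAtMost? P? zero | no ¬p0 = no λ { (zero , (p , _) , _) → ¬p0 p }
leastAtMost? {P} P? (suc k) | no ¬p0 =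
  map′ up down (leastAtMost? (λ n → P? (suc n)) k)
  where
  up : ∃[ d ] (IsLeast (λ n → P (suc n)) d × d ≤ k) →
       ∃[ d ] (IsLeast P d × d ≤ suc k)
  up (d , (p , least) , d≤k) = suc d , (p , least′) , s≤s d≤k
    where
    least′ : ∀ j → P j → suc d ≤ j
    least′ zero    q with () ← ¬p0 q
    least′ (suc j) q = s≤s (least j q)

  down : ∃[ d ] (IsLeast P d × d ≤ suc k) →
         ∃[ d ] (IsLeast (λ n → P (suc n)) d × d ≤ k)
  down (zero  , (p , _) , _) with () ← ¬p0 p
  down (suc d , (p , least) , s≤s d≤k) =
    d , (p , λ j q → s≤s⁻¹ (least (suc j) q)) , d≤k

distanceAtMost? : ∀ G k → Decidable (DistanceAtMost G k)
distanceAtMost? G k u v = leastAtMost? (λ n → walk? G n u v) k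

_² : Graph → Graph
G ² = record
  { order    = order
  ; _~_      = λ u v → u ≢ v × DistanceAtMost G 2 u v
  ; ~-sym    = λ (u≢v , near) → (λ v≡u → u≢v (sym v≡u)) , distanceAtMost-sym G 2 near
  ; ~-irrefl = λ u≡v (u≢v , _) → u≢v u≡v
  ; _~?_     = λ u v → ¬? (u ≟ v) ×-dec distanceAtMost? G 2 u v
  }
  where open Graph G

module _ (H : Graph) where
  open Graph H

  Proper : {C : Set} → (V → C) → Set
  Proper φ = ∀ {u v} → u ~ v → φ u ≢ φ v

  Colorable : ℕ → Set
  Colorable k = Σ[ φ ∈ (V → Fin k) ] Proper φ

  -- Colors are natural numbers: finitely many finite lists use only finitely
  -- many colors, so a countable palette loses no generality. A list represents
  -- a set, hence has no repetitions, so that its length is its cardinality.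
  Choosable : ℕ → Set
  Choosable k =
    (L : V → List ℕ) → (∀ v → Unique (L v)) → (∀ v → k ≤ length (L v)) →
    Σ[ φ ∈ (V → ℕ) ] (Proper φ × (∀ v → φ v ∈ L v))

  IsChromaticNumber : ℕ → Set
  IsChromaticNumber = IsLeast Colorable

  IsListChromaticNumber : ℕ → Set
  IsListChromaticNumber = IsLeast Choosable

{-# OPTIONS --safe #-}

-- Take rows i ∈ Fin R of m points each, and let hubs be transversals of the
-- rows such that any two points in different rows lie on a common hub (a
-- covering array of strength 2). For the incidence graph G of points and hubs,
-- the points induce in G² the complete multipartite graph with R parts of size
-- m, and every hub costs at most one extra colour, so χ(G²) ≤ R + H for H hubs.
--
-- For the list chromatic number, cut a palette into m blocks of a colours and
-- forbid to the x-th point of each row the x-th block. Then no colour serves a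
-- whole row, so each row uses two colours, and m a < 2 R makes this impossible:
-- χℓ(G²) > (m - 1) a.
--
-- If R = s², writing a row as a pair of coordinates in Fin s gives a covering
-- array with only 2 s m² hubs. With m = 3 the list chromatic number is then
-- about 4R/3, while the chromatic number is R + O(√R).
module Submission where

open import Data.Nat using (ℕ; NonZero)
open import Data.Integer using (+_; _-_; _≥_)
open import Data.Product using (Σ-syntax; ∃-syntax; _×_)
open import Defs

open import Data.Empty using (⊥)
open import Data.Fin using
  (Fin; zero; suc; toℕ; combine; remQuot; quotient; remainder; punchIn; inject≤; funToFin; finToFun)
open import Data.Fin.Properties
  using (_≟_; any?; all?; finToFun-funToFin; toℕ-injective; inject≤-injective;
         combine-injective; combine-remQuot; remQuot-combine;
         punchIn-injective; punchInᵢ≢i; injective⇒≤; +↔⊎; *↔×)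
import Data.Integer as ℤ
import Data.Integer.Properties as ℤₚ
open import Data.List using (List; length; lookup; tabulate)
open import Data.List.Membership.Propositional.Properties using (∈-lookup; ∈-tabulate⁻)
open import Data.List.Properties using (length-tabulate)
import Data.List.Relation.Unary.All as All
open import Data.List.Relation.Unary.AllPairs using (_∷_)
open import Data.List.Relation.Unary.Unique.Propositional using (Unique)
open import Data.List.Relation.Unary.Unique.Propositional.Properties using (tabulate⁺)
open import Data.Nat using (suc; zero; _+_; _*_; _≤_; _<_; z≤n; s≤s)
import Data.Nat.Properties as ℕₚ
open import Data.Nat.Tactic.RingSolver using (solve-∀)
open import Data.Product using (∃; _,_; proj₁; proj₂; uncurry)
open import Data.Product.Function.NonDependent.Propositional using (_×-↔_)
open import Data.Product.Properties using (,-injective)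
open import Data.Sum using (_⊎_; inj₁; inj₂)
open import Data.Sum.Function.Propositional using (_⊎-↔_)
open import Data.Sum.Properties using (inj₁-injective)
open import Function using (_∘_; _↔_; Injective; Inverse)
open import Function.Properties.Inverse using (↔-refl; ↔-trans)
open import Relation.Binary using (DecidableEquality)
open import Relation.Binary.PropositionalEquality
  using (_≡_; _≢_; _≗_; refl; sym; trans; cong; cong₂; subst)
open import Relation.Nullary using (Dec; yes; no; ¬_; ¬?; contradiction)
open import Relation.Nullary.Decidable using (map′; _→-dec_; decidable-stable)

-- Least witnesses, search over finite function spaces, distinct representatives

least : {P : ℕ → Set} → (∀ n → Dec (P n)) → ∀ n → P n → ∃ (IsLeast P)
least P? zero    p = zero , p , λ _ _ → z≤n
least P? (suc n) p with P? zero
... | yes p₀ = zero , p₀ , λ _ _ → z≤n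
... | no ¬p₀ with d , pd , minimal ← least (P? ∘ suc) n p =
  suc d , pd , λ { zero q → contradiction q ¬p₀ ; (suc j) q → s≤s (minimal j q) }

-- Decoding the code of a function returns it only up to pointwise equality, so a search over codes
-- needs predicates that respect this equality.
Extensional : ∀ {n m} → ((Fin n → Fin m) → Set) → Set
Extensional P = ∀ {f g} → f ≗ g → P f → P g

anyFunction? : ∀ {n m} {P : (Fin n → Fin m) → Set} → Extensional P →
               (∀ f → Dec (P f)) → Dec (∃ P)
anyFunction? ext P? =
  map′ (λ (k , p) → finToFun k , p)
       (λ (f , p) → funToFin f , ext (sym ∘ finToFun-funToFin f) p)
       (any? (P? ∘ finToFun))

allFunctions? : ∀ {n m} {P : (Fin n → Fin m) → Set} → Extensional P →
                (∀ f → Dec (P f)) → Dec (∀ f → P f)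
allFunctions? ext P? =
  map′ (λ p f → ext (finToFun-funToFin f) (p (funToFin f)))
       (λ p k → p (finToFun k))
       (all? (P? ∘ finToFun))

injective? : ∀ {n m} (f : Fin n → Fin m) → Dec (Injective _≡_ _≡_ f)
injective? f =
  map′ (λ inj {i} {j} → inj i j) (λ inj i j → inj {i} {j})
       (all? λ i → all? λ j → (f i ≟ f j) →-dec (i ≟ j))

uncurry-combine : ∀ {n k} {A : Set} (f : Fin n → Fin k → A) i j →
                  uncurry f (remQuot k (combine i j)) ≡ f i j
uncurry-combine f i j = cong (uncurry f) (remQuot-combine i j)

lookup-injective : {A : Set} {xs : List A} → Unique xs → Injective _≡_ _≡_ (lookup xs)
lookup-injective (_  ∷ _) {zero}  {zero}  _  = refl
lookup-injective (x∉ ∷ _) {zero}  {suc j} eq = contradiction eq (All.lookup x∉ (∈-lookup j))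
lookup-injective (x∉ ∷ _) {suc i} {zero}  eq = contradiction (sym eq) (All.lookup x∉ (∈-lookup i))
lookup-injective (_  ∷ u) {suc i} {suc j} eq = cong suc (lookup-injective u eq)

-- Each index is replaced by one representative of its fibre, so `f` and `g` identify the same
-- indices. This moves colours from an arbitrary palette to a finite one.
relabel : ∀ {n} {A : Set} → DecidableEquality A → (f : Fin n → A) →
          Σ[ g ∈ (Fin n → Fin n) ]
            (∀ {p q} → f p ≡ f q → g p ≡ g q) × (∀ {p q} → g p ≡ g q → f p ≡ f q)
relabel {n} {A} _≟ᴬ_ f =
  (λ p → position (p , refl)) , position-cong _ _ ,
  λ {p} {q} eq → trans (sym (f-position (p , refl))) (trans (cong f eq) (f-position (q , refl)))
  where
  -- The result depends on `c` alone: the argument only excludes an empty fibre.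
  position : ∀ {c} → ∃ (λ q → f q ≡ c) → Fin n
  position {c} e with any? (λ q → f q ≟ᴬ c)
  ... | yes (q , _) = q
  ... | no ¬e       = contradiction e ¬e

  f-position : ∀ {c} (e : ∃ λ q → f q ≡ c) → f (position e) ≡ c
  f-position {c} e with any? (λ q → f q ≟ᴬ c)
  ... | yes (_ , eq) = eq
  ... | no ¬e        = contradiction e ¬e

  position-cong : ∀ {c c′} (e : ∃ λ q → f q ≡ c) (e′ : ∃ λ q → f q ≡ c′) →
                  c ≡ c′ → position e ≡ position e′
  position-cong {c} e e′ refl with any? (λ q → f q ≟ᴬ c)
  ... | yes _ = refl
  ... | no ¬e = contradiction e ¬e

-- Greedy choice, with the first list served last: if all its `k` entries were taken, sending each
-- entry to its taker would inject `Fin k` into the other lists, which are fewer than `k`.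
distinctRepresentatives :
  ∀ {n k} {A : Set} → DecidableEquality A → n ≤ k → (L : Fin n → Fin k → A) →
  (∀ v → Injective _≡_ _≡_ (L v)) →
  Σ[ ι ∈ (Fin n → Fin k) ] Injective _≡_ _≡_ (λ v → L v (ι v))
distinctRepresentatives {zero} _ _ _ _ = (λ ()) , λ { {()} }
distinctRepresentatives {suc n} {k} {A} _≟ᴬ_ n<k L inj
  with ι , ι-inj ← distinctRepresentatives _≟ᴬ_ (ℕₚ.<⇒≤ n<k) (L ∘ suc) (inj ∘ suc)
  with any? (λ i → ¬? (any? λ u → L zero i ≟ᴬ L (suc u) (ι u)))
... | yes (i , fresh) = ι′ , ι′-inj
  where
  ι′ : Fin (suc n) → Fin k
  ι′ zero    = i
  ι′ (suc u) = ι u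

  ι′-inj : Injective _≡_ _≡_ (λ v → L v (ι′ v))
  ι′-inj {zero}  {zero}  _  = refl
  ι′-inj {zero}  {suc u} eq = contradiction (u , eq) fresh
  ι′-inj {suc u} {zero}  eq = contradiction (u , sym eq) fresh
  ι′-inj {suc u} {suc v} eq = cong suc (ι-inj eq)
... | no ¬fresh = contradiction n<k (ℕₚ.≤⇒≯ (injective⇒≤ used-inj))
  where
  used : ∀ i → ∃ λ u → L zero i ≡ L (suc u) (ι u)
  used i = decidable-stable (any? λ u → L zero i ≟ᴬ L (suc u) (ι u)) (λ ¬u → ¬fresh (i , ¬u))

  used-inj : Injective _≡_ _≡_ (proj₁ ∘ used)
  used-inj {i} {j} eq = inj zero
    (trans (proj₂ (used i)) (trans (cong (λ u → L (suc u) (ι u)) eq) (sym (proj₂ (used j)))))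

-- Chromatic numbers of a finite graph

module _ (H : Graph) where
  open Graph H

  Proper-cong : {C : Set} {φ ψ : V → C} → φ ≗ ψ → Proper H φ → Proper H ψ
  Proper-cong φ≗ψ proper {u} {v} e eq =
    proper e (trans (φ≗ψ u) (trans eq (sym (φ≗ψ v))))

  proper? : ∀ {k} (φ : V → Fin k) → Dec (Proper H φ)
  proper? φ =
    map′ (λ p {u} {v} → p u v) (λ p u v → p {u} {v})
         (all? λ u → all? λ v → (u ~? v) →-dec ¬? (φ u ≟ φ v))

  colorable? : ∀ k → Dec (Colorable H k)
  colorable? k = anyFunction? Proper-cong proper?

  chromaticNumber : ∀ {k} → Colorable H k → ∃ (IsChromaticNumber H)
  chromaticNumber = least colorable? _

  -- Lists as injective families of size exactly k over a palette C; a choice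
  -- picks an index in each list.
  ChoosableFrom : Set → ℕ → Set
  ChoosableFrom C k =
    (L : V → Fin k → C) → (∀ v → Injective _≡_ _≡_ (L v)) →
    Σ[ ι ∈ (V → Fin k) ] Proper H (λ v → L v (ι v))

  Choosable⇒ChoosableFrom : ∀ {k} → Choosable H k → ChoosableFrom ℕ k
  Choosable⇒ChoosableFrom {k} choose L inj
    with φ , proper , φ∈ ← choose (tabulate ∘ L) (λ v → tabulate⁺ (inj v))
                                  (λ v → ℕₚ.≤-reflexive (sym (length-tabulate (L v)))) =
    (λ v → proj₁ (∈-tabulate⁻ (φ∈ v))) ,
    Proper-cong (λ v → proj₂ (∈-tabulate⁻ (φ∈ v))) proper

  ChoosableFrom⇒Choosable : ∀ {k} → ChoosableFrom ℕ k → Choosable H k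
  ChoosableFrom⇒Choosable {k} choose L unique k≤
    with ι , proper ← choose
      (λ v i → lookup (L v) (inject≤ i (k≤ v)))
      (λ v eq → inject≤-injective (k≤ v) (k≤ v) _ _ (lookup-injective (unique v) eq)) =
    _ , proper , λ v → ∈-lookup _

  embedPalette : ∀ {k} {C D : Set} (f : C → D) → Injective _≡_ _≡_ f →
                 ChoosableFrom D k → ChoosableFrom C k
  embedPalette f f-inj choose L inj
    with ι , proper ← choose (λ v → f ∘ L v) (λ v → inj v ∘ f-inj) =
    ι , λ e eq → proper e (cong f eq)

  -- An assignment involves at most `order * k` colours. Relabelling them keeps each list injective
  -- because equalities are reflected, and a proper choice carries back because they are preserved.
  finitePalette : ∀ {k} {C : Set} → DecidableEquality C →
                  ChoosableFrom (Fin (order * k)) k → ChoosableFrom C k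
  finitePalette {k} {C} _≟ᶜ_ choose L inj = ι , λ {u} {v} e eq →
    proper e (g-cong (trans (uncurry-combine L u (ι u)) (trans eq (sym (uncurry-combine L v (ι v))))))
    where
    flat : Fin (order * k) → C
    flat = uncurry L ∘ remQuot k

    relabelling = relabel _≟ᶜ_ flat
    g      = proj₁ relabelling
    g-cong = proj₁ (proj₂ relabelling)

    g-injective : ∀ v → Injective _≡_ _≡_ (λ i → g (combine v i))
    g-injective v {i} {j} eq = inj v
      (trans (sym (uncurry-combine L v i)) (trans (proj₂ (proj₂ relabelling) eq) (uncurry-combine L v j)))

    choice = choose (λ v i → g (combine v i)) g-injective
    ι      = proj₁ choice
    proper = proj₂ choice

  choosableFrom? : ∀ m k → Dec (ChoosableFrom (Fin m) k)
  choosableFrom? m k =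
    map′ to from (allFunctions? ext λ L → all? (λ v → injective? (row L v)) →-dec
      anyFunction? (λ {ι} {κ} ι≗κ → Proper-cong λ v → cong (row L v) (ι≗κ v))
                   (λ ι → proper? λ v → row L v (ι v)))
    where
    row : (Fin (order * k) → Fin m) → V → Fin k → Fin m
    row L v i = L (combine v i)

    P : (Fin (order * k) → Fin m) → Set
    P L = (∀ v → Injective _≡_ _≡_ (row L v)) →
          Σ[ ι ∈ (V → Fin k) ] Proper H (λ v → row L v (ι v))

    ext : Extensional P
    ext L≗M p inj
      with ι , proper ← p (λ v eq → inj v (trans (sym (L≗M _)) (trans eq (L≗M _)))) =
      ι , Proper-cong (λ v → L≗M _) proper

    to : (∀ L → P L) → ChoosableFrom (Fin m) k
    to p L inj
      with ι , proper ← p (uncurry L ∘ remQuot k)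
             (λ v {i} {j} eq → inj v
               (trans (sym (uncurry-combine L v i)) (trans eq (uncurry-combine L v j)))) =
      ι , Proper-cong (λ v → uncurry-combine L v (ι v)) proper

    from : ChoosableFrom (Fin m) k → ∀ L → P L
    from choose L = choose (row L)

  -- This makes the least choosable `k`, the list chromatic number, available by search.
  choosable? : ∀ k → Dec (Choosable H k)
  choosable? k =
    map′ (ChoosableFrom⇒Choosable ∘ finitePalette ℕₚ._≟_)
         (embedPalette toℕ toℕ-injective ∘ Choosable⇒ChoosableFrom)
         (choosableFrom? (order * k) k)

  order-choosable : Choosable H order
  order-choosable = ChoosableFrom⇒Choosable λ L inj →
    let ι , ι-inj = distinctRepresentatives ℕₚ._≟_ ℕₚ.≤-refl L inj
    in ι , λ e eq → ~-irrefl (ι-inj eq) e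

  listChromaticNumber : ∃ (IsListChromaticNumber H)
  listChromaticNumber = least choosable? order order-choosable

  ChoosableFrom-mono : ∀ {C j k} → j ≤ k → ChoosableFrom C j → ChoosableFrom C k
  ChoosableFrom-mono j≤k choose L inj
    with ι , proper ← choose (λ v i → L v (inject≤ i j≤k))
                             (λ v eq → inject≤-injective j≤k j≤k _ _ (inj v eq)) =
    _ , proper

-- Covering arrays and their incidence graphs

record CoveringArray (hubs rows symbols : ℕ) : Set where
  field
    entry : Fin hubs → Fin rows → Fin symbols
    cover : ∀ {i j} → i ≢ j → ∀ x y → ∃[ h ] (entry h i ≡ x × entry h j ≡ y)

module Incidence {hubs rows symbols : ℕ} (A : CoveringArray hubs rows symbols) where
  open CoveringArray A

  Vertex : Set
  Vertex = (Fin rows × Fin symbols) ⊎ Fin hubs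

  Incident : Vertex → Vertex → Set
  Incident (inj₁ (i , x)) (inj₂ h)       = entry h i ≡ x
  Incident (inj₂ h)       (inj₁ (i , x)) = entry h i ≡ x
  Incident (inj₁ _)       (inj₁ _)       = ⊥
  Incident (inj₂ _)       (inj₂ _)       = ⊥

  incident-sym : ∀ p q → Incident p q → Incident q p
  incident-sym (inj₁ _) (inj₂ _) e = e
  incident-sym (inj₂ _) (inj₁ _) e = e

  incident-irrefl : ∀ p → ¬ Incident p p
  incident-irrefl (inj₁ _) ()
  incident-irrefl (inj₂ _) ()

  incident? : ∀ p q → Dec (Incident p q)
  incident? (inj₁ (i , x)) (inj₂ h)       = entry h i ≟ x
  incident? (inj₂ h)       (inj₁ (i , x)) = entry h i ≟ x
  incident? (inj₁ _)       (inj₁ _)       = no λ ()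
  incident? (inj₂ _)       (inj₂ _)       = no λ ()

  vertices : Fin (rows * symbols + hubs) ↔ Vertex
  vertices = ↔-trans +↔⊎ (*↔× ⊎-↔ ↔-refl)

  open Inverse vertices using ()
    renaming (to to decode; from to encode; strictlyInverseˡ to decode-encode) public

  decode-injective : ∀ {u v} → decode u ≡ decode v → u ≡ v
  decode-injective {u} {v} eq =
    trans (sym (Inverse.strictlyInverseʳ vertices u))
          (trans (cong encode eq) (Inverse.strictlyInverseʳ vertices v))

  graph : Graph
  graph = record
    { order    = rows * symbols + hubs
    ; _~_      = λ u v → Incident (decode u) (decode v)
    ; ~-sym    = λ {u} {v} → incident-sym (decode u) (decode v)
    ; ~-irrefl = λ { {u} refl → incident-irrefl (decode u) }
    ; _~?_     = λ u v → incident? (decode u) (decode v)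
    }

  point : Fin rows → Fin symbols → Graph.V graph
  point i x = encode (inj₁ (i , x))

  private
    point~hub : ∀ {h i x} → entry h i ≡ x → Graph._~_ graph (point i x) (encode (inj₂ h))
    point~hub {h} {i} {x} e
      rewrite decode-encode (inj₁ (i , x)) | decode-encode (inj₂ h) = e

    points-not-adjacent : ∀ {i j x y} → ¬ Graph._~_ graph (point i x) (point j y)
    points-not-adjacent {i} {j} {x} {y} e
      rewrite decode-encode (inj₁ (i , x)) | decode-encode (inj₁ (j , y)) = e

    point-injectiveˡ : ∀ {i j x y} → point i x ≡ point j y → i ≡ j
    point-injectiveˡ {i} {j} {x} {y} eq =
      proj₁ (,-injective (inj₁-injective
        (trans (sym (decode-encode (inj₁ (i , x)))) (trans (cong decode eq) (decode-encode _)))))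

  -- A common hub gives a walk of length 2; none is shorter, because the points are distinct and
  -- points are never adjacent.
  points-near : ∀ {i j} → i ≢ j → ∀ x y → Graph._~_ (graph ²) (point i x) (point j y)
  points-near {i} {j} i≢j x y with h , hi , hj ← cover i≢j x y =
    i≢j ∘ point-injectiveˡ ,
    2 , (point~hub hi ∷ (Graph.~-sym graph {point j y} (point~hub hj) ∷ []) , minimal) , ℕₚ.≤-refl
    where
    -- The endpoints are variables with equations, since encoded points would block matching a walk
    -- against `[]`.
    shorter : ∀ {p q n} → p ≡ point i x → q ≡ point j y → Walk graph p q n → 2 ≤ n
    shorter p≡ q≡ []           = contradiction (point-injectiveˡ (trans (sym p≡) q≡)) i≢j
    shorter refl refl (e ∷ []) = contradiction e points-not-adjacent
    shorter _ _ (_ ∷ (_ ∷ _))  = s≤s (s≤s z≤n)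

    minimal : ∀ n → Walk graph (point i x) (point j y) n → 2 ≤ n
    minimal _ = shorter refl refl

  -- The colour classes of the square: one per row and one per hub.
  rowOrHub : Vertex → Fin rows ⊎ Fin hubs
  rowOrHub (inj₁ (i , _)) = inj₁ i
  rowOrHub (inj₂ h)       = inj₂ h

  -- A hub meets each row in a single point, and each hub is alone in its class.
  common-neighbour : ∀ p q r → Incident p q → Incident q r → rowOrHub p ≡ rowOrHub r → p ≡ r
  common-neighbour (inj₁ _) (inj₂ _) (inj₁ _) refl refl refl = refl
  common-neighbour (inj₂ _) (inj₁ _) (inj₂ _) _    _    refl = refl

  incident⇒≢ : ∀ p q → Incident p q → rowOrHub p ≢ rowOrHub q
  incident⇒≢ (inj₁ _) (inj₂ _) _ ()
  incident⇒≢ (inj₂ _) (inj₁ _) _ ()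

  -- Distinct vertices of one class are not adjacent, as edges join points to hubs, and they have no
  -- common neighbour.
  square-colorable : Colorable (graph ²) (rows + hubs)
  square-colorable = colour , proper
    where
    colours : Fin (rows + hubs) ↔ (Fin rows ⊎ Fin hubs)
    colours = +↔⊎

    colour : Graph.V graph → Fin (rows + hubs)
    colour = Inverse.from colours ∘ rowOrHub ∘ decode

    colour-reflects : ∀ {u v} → colour u ≡ colour v → rowOrHub (decode u) ≡ rowOrHub (decode v)
    colour-reflects eq =
      trans (sym (Inverse.strictlyInverseˡ colours _))
            (trans (cong (Inverse.to colours) eq) (Inverse.strictlyInverseˡ colours _))

    proper : Proper (graph ²) colour
    proper (u≢v , _ , ([] , _) , _) eq = u≢v refl
    proper {u} {v} (u≢v , _ , (e ∷ [] , _) , _) eq =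
      incident⇒≢ (decode u) (decode v) e (colour-reflects eq)
    proper {u} {v} (u≢v , _ , (_∷_ {v = w} e (f ∷ []) , _) , _) eq =
      u≢v (decode-injective
        (common-neighbour (decode u) (decode w) (decode v) e f (colour-reflects eq)))
    proper (u≢v , _ , (_ ∷ (_ ∷ (_ ∷ _)) , _) , s≤s (s≤s ())) eq

-- Lower bound for the list chromatic number

square-not-choosable :
  ∀ {hubs rows n} a (A : CoveringArray hubs rows (suc n)) → suc n * a < rows * 2 →
  ¬ ChoosableFrom (Incidence.graph A ²) (Fin (suc n * a)) (n * a)
square-not-choosable {hubs} {rows} {n} a A few choose =
  -- Two colours per row, all distinct, would exceed the palette.
  contradiction few (ℕₚ.≤⇒≯ (injective⇒≤ pairColour-injective))
  where
  open Incidence A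

  -- Enumerates the colours outside block `x`: `punchIn x` skips that block and the position inside
  -- a block is kept.
  avoiding : Fin (suc n) → Fin (n * a) → Fin (suc n * a)
  avoiding x k = combine (punchIn x (quotient a k)) (remainder {n} a k)

  avoiding-injective : ∀ x → Injective _≡_ _≡_ (avoiding x)
  avoiding-injective x {k} {l} eq with b , c ← combine-injective _ _ _ _ eq =
    trans (sym (combine-remQuot {n} a k))
          (trans (cong₂ combine (punchIn-injective x _ _ b) c) (combine-remQuot {n} a l))

  block : Fin (suc n * a) → Fin (suc n)
  block = quotient a

  block-avoiding : ∀ x k → block (avoiding x k) ≢ x
  block-avoiding x k eq = punchInᵢ≢i x (quotient a k)
    (trans (sym (cong proj₁ (remQuot-combine (punchIn x (quotient a k)) (remainder {n} a k)))) eq)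

  -- The forbidden block of a hub is immaterial; it only has to get some list.
  forbidden : Vertex → Fin (suc n)
  forbidden (inj₁ (_ , x)) = x
  forbidden (inj₂ _)       = zero

  choice = choose (avoiding ∘ forbidden ∘ decode) (λ v → avoiding-injective (forbidden (decode v)))

  colour : Graph.V graph → Fin (suc n * a)
  colour v = avoiding (forbidden (decode v)) (proj₁ choice v)

  block-colour : ∀ i x → block (colour (point i x)) ≢ x
  block-colour i x eq =
    block-avoiding _ (proj₁ choice (point i x))
      (trans eq (sym (cong forbidden (decode-encode (inj₁ (i , x))))))

  -- A point forbidding the block of the first colour receives another colour.
  witness : Fin rows → Fin 2 → Fin (suc n)
  witness i zero       = zero
  witness i (suc zero) = block (colour (point i zero))

  rowColour : Fin rows → Fin 2 → Fin (suc n * a)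
  rowColour i t = colour (point i (witness i t))

  -- Points of different rows are adjacent in the square; within a row, the second colour avoids the
  -- block of the first.
  rowColour-injective : ∀ i j s t → rowColour i s ≡ rowColour j t → (i , s) ≡ (j , t)
  rowColour-injective i j s t eq with i ≟ j
  rowColour-injective i j s t eq | no i≢j =
    contradiction eq (proj₂ choice (points-near i≢j (witness i s) (witness j t)))
  rowColour-injective i .i zero       zero       eq | yes refl = refl
  rowColour-injective i .i (suc zero) (suc zero) eq | yes refl = refl
  rowColour-injective i .i zero       (suc zero) eq | yes refl =
    contradiction (cong block (sym eq)) (block-colour i _)
  rowColour-injective i .i (suc zero) zero       eq | yes refl =
    contradiction (cong block eq) (block-colour i _)

  pairColour : Fin (rows * 2) → Fin (suc n * a)
  pairColour = uncurry rowColour ∘ remQuot 2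

  pairColour-injective : Injective _≡_ _≡_ pairColour
  pairColour-injective {p} {q} eq =
    trans (sym (combine-remQuot {rows} 2 p))
          (trans (cong (uncurry combine) (rowColour-injective _ _ _ _ eq)) (combine-remQuot {rows} 2 q))

-- A covering array with few hubs

coordinateArray : ∀ s m → CoveringArray (2 * (s * (m * m))) (s * s) m
coordinateArray s m = record { entry = entry ; cover = cover }
  where
  coordinate : Fin 2 → Fin (s * s) → Fin s
  coordinate zero       = quotient s
  coordinate (suc zero) = remainder {s} s

  Hub : Set
  Hub = Fin 2 × (Fin s × (Fin m × Fin m))

  hubs : Fin (2 * (s * (m * m))) ↔ Hub
  hubs = ↔-trans *↔× (↔-refl ×-↔ ↔-trans *↔× (↔-refl ×-↔ *↔×))

  open Inverse hubs using ()
    renaming (to to decode; from to encode; strictlyInverseˡ to decode-encode)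

  -- The hub takes `x` on the rows whose coordinate `t` equals `c`, and `y` on all others.
  value : Hub → Fin (s * s) → Fin m
  value (t , c , x , y) i with coordinate t i ≟ c
  ... | yes _ = x
  ... | no  _ = y

  entry : Fin (2 * (s * (m * m))) → Fin (s * s) → Fin m
  entry = value ∘ decode

  coordinates-differ : ∀ {i j} → i ≢ j → ∃[ t ] coordinate t i ≢ coordinate t j
  coordinates-differ {i} {j} i≢j with quotient s i ≟ quotient s j
  ... | no q≢ = zero , q≢
  ... | yes q≡ = suc zero , λ r≡ →
    i≢j (trans (sym (combine-remQuot {s} s i)) (trans (cong₂ combine q≡ r≡) (combine-remQuot {s} s j)))

  value-on : ∀ t {c} i x y → coordinate t i ≡ c → value (t , c , x , y) i ≡ x
  value-on t {c} i x y eq with coordinate t i ≟ c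
  ... | yes _ = refl
  ... | no ne = contradiction eq ne

  value-off : ∀ t {c} j x y → coordinate t j ≢ c → value (t , c , x , y) j ≡ y
  value-off t {c} j x y ne with coordinate t j ≟ c
  ... | yes eq = contradiction eq ne
  ... | no _   = refl

  cover : ∀ {i j} → i ≢ j → ∀ x y → ∃[ h ] (entry h i ≡ x × entry h j ≡ y)
  cover {i} {j} i≢j x y with t , t≢ ← coordinates-differ i≢j =
    encode hub ,
    trans (cong (λ k → value k i) (decode-encode hub)) (value-on t i x y refl) ,
    trans (cong (λ k → value k j) (decode-encode hub)) (value-off t j x y (t≢ ∘ sym))
    where
    hub : Hub
    -- Coordinate `t` separates the rows, so fixing its value at `i` leaves `j` on the other side.
    hub = t , coordinate t i , x , y

-- The gap and the choice of parameters

+-≤⇒≥-minus : ∀ {m n o} → m + n ≤ o → + o - + n ≥ + m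
+-≤⇒≥-minus {m} {n} {o} le =
  subst (+ m ℤ.≤_)
        (sym (trans (ℤₚ.m-n≡m⊖n o n) (ℤₚ.⊖-≥ (ℕₚ.m+n≤o⇒n≤o m le))))
        (ℤ.+≤+ (ℕₚ.m+n≤o⇒m≤o∸n m le))

square-gap :
  ∀ {hubs rows n} a N → CoveringArray hubs rows (suc n) →
  suc n * a < rows * 2 → N + (rows + hubs) ≤ suc (n * a) →
  Σ[ G ∈ Graph ] ∃[ χℓ ] ∃[ χ ]
    (IsListChromaticNumber (G ²) χℓ × IsChromaticNumber (G ²) χ × (+ χℓ) - (+ χ) ≥ + N)
square-gap {n = n} a N A few gap
  with χℓ , χℓ-least ← listChromaticNumber (Incidence.graph A ²)
  with χ , χ-least ← chromaticNumber (Incidence.graph A ²) (Incidence.square-colorable A) =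
  graph , χℓ , χ , χℓ-least , χ-least ,
  +-≤⇒≥-minus (ℕₚ.≤-trans (ℕₚ.+-monoʳ-≤ N (proj₂ χ-least _ square-colorable)) (ℕₚ.≤-trans gap large))
  where
  open Incidence A

  -- Otherwise choosability would pass up to lists of size `n * a` and then restrict to the finite
  -- palette.
  large : n * a < χℓ
  large = ℕₚ.≰⇒> λ χℓ≤ → square-not-choosable a A few
    (embedPalette (graph ²) toℕ toℕ-injective
      (ChoosableFrom-mono (graph ²) χℓ≤ (Choosable⇒ChoosableFrom (graph ²) (proj₁ χℓ-least))))

mainTheorem3 : (N : ℕ) → .{{NonZero N}} →
    Σ[ G ∈ Graph ] ∃[ χℓ ] ∃[ χ ]
    (IsListChromaticNumber (G ²) χℓ × IsChromaticNumber (G ²) χ × (+ χℓ) - (+ χ) ≥ + N)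
mainTheorem3 N = square-gap (a u) N (coordinateArray (s u) 3) (few-colours u) gap
  where
  -- The bounds differ by 3u² - 52u - 18, which is first positive at u = 18 and from there grows
  -- faster than `N`.
  u = 18 + N

  -- s makes s² ≡ 1 modulo 3, and a is the largest integer with 3 a < 2 s².
  s a : ℕ → ℕ
  s u = 1 + 3 * u
  a u = 6 * (u * u) + 4 * u

  few-colours : ∀ u → 3 * a u < s u * s u * 2
  -- Here 2s² = 3a + 2: one unit gives strictness, the other is the slack `{1}`.
  few-colours u = ℕₚ.m+n≤o⇒m≤o (suc (3 * a u)) {1} (ℕₚ.≤-reflexive (identity u))
    where
    identity : ∀ u → suc (3 * (6 * (u * u) + 4 * u)) + 1 ≡ (1 + 3 * u) * (1 + 3 * u) * 2
    identity = solve-∀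

  gap : N + (s u * s u + 2 * (s u * (3 * 3))) ≤ suc (2 * a u)
  -- Adding the explicit slack 18 + 55N + 3N² turns the inequality into a polynomial identity.
  gap = ℕₚ.m+n≤o⇒m≤o _ (ℕₚ.≤-reflexive (identity N))
    where
    identity : ∀ N → let u = 18 + N ; s = 1 + 3 * u in
      N + (s * s + 2 * (s * 9)) + (18 + 55 * N + 3 * (N * N)) ≡ suc (2 * (6 * (u * u) + 4 * u))
    identity = solve-∀
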